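{- For every positive integer $n$ with $4 \mid n$, $$t^3_2(n, K_4^3 - e) \ge n/2 - 1.$$
   Context: A 3-graph $H$ is a pair $(V(H),E(H))$ where $V(H)$ is a finite set of vertices and $E(H)$ is a set of 3-element subsets of $V(H)$; its order is $|V(H)|$. For a 2-set $T$ of vertices, $\deg(T)$ is the number of vertices $v$ such that $T\cup\{v\}$ is an edge of $H$, and $\delta_2(H)$ is the minimum of $\deg(T)$ over all 2-element subsets $T$ of $V(H)$. $K_4^3-e$ denotes the 3-graph on 4 vertices with exactly 3 edges. For a 3-graph $F$, an $F$-factor in $H$ is a spanning subgraph of $H$ consisting of vertex-disjoint copies of $F$ (copies are not required to be induced). For $n$ divisible by $|V(F)|$, $t^3_2(n,F)$ is the smallest integer $d$ such that every 3-graph $H$ of order $n$ with $\delta_2(H)\ge d$ contains an $F$-factor. -}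

module Defs where

open import Data.Bool.Base using (Bool; T)
import Data.Bool.Properties as Bool
open import Data.Fin.Base using (Fin; zero; suc)
open import Data.Fin.Properties using (any?) renaming (_≟_ to _≟ᶠ_)
open import Data.Fin.Subset using (Subset; inside; outside; _∪_; ⁅_⁆; ∣_∣)
open import Data.Fin.Subset.Properties using (_∈?_)
open import Data.Integer.Base as ℤ using (ℤ; +_)
open import Data.List.Base using (List; []; _∷_; _++_; map; filter; length)
open import Data.List.Extrema.Nat using (min)
open import Data.List.Membership.Propositional using () renaming (_∈_ to _∈ˡ_)
open import Data.List.Membership.Propositional.Properties using (∈-map⁺; ∈-++⁺ˡ; ∈-++⁺ʳ; ∈-filter⁺)
open import Data.List.Relation.Unary.Any using (here)
open import Data.Nat.Base using (ℕ; zero; suc)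
open import Data.Nat.Properties using (_≟_)
open import Data.Product.Base using (_×_; _,_; ∃₂; proj₁)
open import Data.Vec.Base using ([]; _∷_; tabulate)
open import Data.Vec.Properties using (≡-dec)
open import Function.Definitions using (Injective)
open import Relation.Binary.PropositionalEquality using (_≡_; _≢_; refl)
open import Relation.Nullary.Decidable using (Dec; ⌊_⌋; toWitness; _×-dec_; ¬?; T?)

-- The vertex set of a 3-graph of order n is taken to be Fin n; its edge set
-- is given by its indicator function on the subsets of Fin n.
record 3Graph (n : ℕ) : Set where
  field
    edge    : Subset n → Bool
    uniform : ∀ e → T (edge e) → ∣ e ∣ ≡ 3

  Edge : Subset n → Set
  Edge e = T (edge e)

open 3Graph public

allSubsets : ∀ n → List (Subset n)
allSubsets zero    = [] ∷ []
allSubsets (suc n) = map (inside ∷_) (allSubsets n) ++ map (outside ∷_) (allSubsets n)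

∈-allSubsets : ∀ {n} (p : Subset n) → p ∈ˡ allSubsets n
∈-allSubsets []            = here refl
∈-allSubsets (inside  ∷ p) = ∈-++⁺ˡ (∈-map⁺ (inside ∷_) (∈-allSubsets p))
∈-allSubsets (outside ∷ p) = ∈-++⁺ʳ (map (inside ∷_) (allSubsets _)) (∈-map⁺ (outside ∷_) (∈-allSubsets p))

pairs : ∀ n → List (Subset n)
pairs n = filter (λ p → ∣ p ∣ ≟ 2) (allSubsets n)

∈-pairs : ∀ {n} (p : Subset n) → ∣ p ∣ ≡ 2 → p ∈ˡ pairs n
∈-pairs p = ∈-filter⁺ (λ q → ∣ q ∣ ≟ 2) (∈-allSubsets p)

-- A vertex v lying in a 2-set p is not counted, since p ∪ ⁅ v ⁆ is then not
-- a 3-set.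
deg : ∀ {n} → 3Graph n → Subset n → ℕ
deg H p = ∣ tabulate (λ v → edge H (p ∪ ⁅ v ⁆)) ∣

-- The first argument of min is the value on the empty list.  As no degree
-- exceeds n, it does not affect the minimum when n ≥ 2.
δ₂ : ∀ {n} → 3Graph n → ℕ
δ₂ {n} H = min n (map (deg H) (pairs n))

image : ∀ {m n} → (Fin m → Fin n) → Subset m → Subset n
image f p = tabulate (λ v → ⌊ any? (λ x → (x ∈? p) ×-dec (f x ≟ᶠ v)) ⌋)

-- A not necessarily induced copy of F in H.
record Copy {m n} (F : 3Graph m) (H : 3Graph n) : Set where
  field
    embed     : Fin m → Fin n
    injective : Injective _≡_ _≡_ embed
    preserves : ∀ e → Edge F e → Edge H (image embed e)

open Copy public

record Factor {m n} (F : 3Graph m) (H : 3Graph n) : Set where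
  field
    count    : ℕ
    copy     : Fin count → Copy F H
    disjoint : ∀ i j x y → embed (copy i) x ≡ embed (copy j) y → i ≡ j
    spanning : ∀ v → ∃₂ λ i x → embed (copy i) x ≡ v

-- d is large enough as a minimum-codegree condition in order n.
ForcesFactor : ∀ {m} → ℕ → 3Graph m → ℤ → Set
ForcesFactor n F d = (H : 3Graph n) → d ℤ.≤ + δ₂ H → Factor F H

-- "t = t₂³(n,F)", for n divisible by the order of F.
IsThreshold : ∀ {m} → ℕ → 3Graph m → ℤ → Set
IsThreshold n F t = ForcesFactor n F t × (∀ d → ForcesFactor n F d → t ℤ.≤ d)

-- All 3-subsets of Fin 4 are edges except {1,2,3}.
K₄³-e : 3Graph 4
K₄³-e = record
  { edge    = λ e → ⌊ isEdge? e ⌋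
  ; uniform = λ e h → proj₁ (toWitness {a? = isEdge? e} h)
  }
  where
  omitted : Subset 4
  omitted = outside ∷ inside ∷ inside ∷ inside ∷ []

  isEdge? : ∀ e → Dec (∣ e ∣ ≡ 3 × e ≢ omitted)
  isEdge? e = (∣ e ∣ ≟ 3) ×-dec ¬? (≡-dec Bool._≟_ e omitted)

K₄³-e-size : length (filter (λ e → T? (edge K₄³-e e)) (allSubsets 4)) ≡ 3
K₄³-e-size = refl

{-# OPTIONS --safe #-}

-- Fix a vertex set A and take as edges the triples meeting A in an odd number
-- of vertices.  Every copy of K₄³-e then has 1 or 4 vertices in A, so a factor
-- forces ∣A∣ ≡ n/4 (mod 3).  The minimum codegree is at least n/2 - 2 both for
-- ∣A∣ = n/2 and for ∣A∣ = n/2 + 1, and one of these two sizes violates the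
-- congruence.

module Submission where

open import Defs
open import Data.Bool.Properties using (T-≡)
open import Data.Fin.Base using (Fin; zero; suc)
open import Data.Fin.Properties using (any?; suc-injective) renaming (_≟_ to _≟ᶠ_)
open import Data.Fin.Subset
  using (Subset; Side; inside; outside; ⊤; ⊥; ⁅_⁆; ∁; _∪_; _∩_; ∣_∣; _∈_; _∉_; _⊆_; Empty)
open import Data.Fin.Subset.Properties
import Data.Integer.Base as ℤ
import Data.Integer.Properties as ℤ
import Data.List.Base as List
open import Data.List.Extrema.Nat using (v≤min⁺)
open import Data.List.Membership.Propositional.Properties using (∈-filter⁻)
import Data.List.Relation.Unary.All as All
import Data.List.Relation.Unary.All.Properties as All
open import Data.Nat.Base using (ℕ; zero; suc; _+_; _*_; _∸_; _<_; _/_; _%_; z≤n; s≤s)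
  renaming (_≤_ to _≤ⁿ_)
open import Data.Nat.DivMod using (m*n/n≡m)
open import Data.Nat.ListAction using (sum)
import Data.Nat.Properties as ℕ
open import Data.Nat.Tactic.RingSolver using (solve-∀)
open import Data.Product.Base using (_×_; _,_; ∃; proj₁; proj₂)
open import Data.Sum.Base using (inj₁; inj₂)
open import Data.Vec.Base using ([]; _∷_; tabulate; lookup; here; there)
open import Data.Vec.Properties using (lookup∘tabulate; []=⇒lookup; lookup⇒[]=)
open import Function.Base using (_∘_)
open import Function.Bundles using (Equivalence)
open import Function.Definitions using (Injective)
open import Relation.Binary.PropositionalEquality
  using (_≡_; refl; sym; trans; cong; cong₂; subst; module ≡-Reasoning)
open import Relation.Nullary.Decidable using (Dec; yes; no; ⌊_⌋; toWitness; fromWitness; _×-dec_)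
open import Relation.Nullary.Negation using (¬_; contradiction)

private
  variable
    m n : ℕ

-- Sizes of subsets

∣p∣≡∣p∩q∣+∣p∩∁q∣ : (p q : Subset n) → ∣ p ∣ ≡ ∣ p ∩ q ∣ + ∣ p ∩ ∁ q ∣
∣p∣≡∣p∩q∣+∣p∩∁q∣ []            []            = refl
∣p∣≡∣p∩q∣+∣p∩∁q∣ (outside ∷ p) (_       ∷ q) = ∣p∣≡∣p∩q∣+∣p∩∁q∣ p q
∣p∣≡∣p∩q∣+∣p∩∁q∣ (inside  ∷ p) (inside  ∷ q) = cong suc (∣p∣≡∣p∩q∣+∣p∩∁q∣ p q)
∣p∣≡∣p∩q∣+∣p∩∁q∣ (inside  ∷ p) (outside ∷ q) =
  trans (cong suc (∣p∣≡∣p∩q∣+∣p∩∁q∣ p q)) (sym (ℕ.+-suc _ _))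

disjoint⇒∣p∪q∣≡∣p∣+∣q∣ : (p q : Subset n) → Empty (p ∩ q) → ∣ p ∪ q ∣ ≡ ∣ p ∣ + ∣ q ∣
disjoint⇒∣p∪q∣≡∣p∣+∣q∣ []            []            _ = refl
disjoint⇒∣p∪q∣≡∣p∣+∣q∣ (outside ∷ p) (outside ∷ q) e = disjoint⇒∣p∪q∣≡∣p∣+∣q∣ p q (drop-∷-Empty e)
disjoint⇒∣p∪q∣≡∣p∣+∣q∣ (inside  ∷ p) (outside ∷ q) e =
  cong suc (disjoint⇒∣p∪q∣≡∣p∣+∣q∣ p q (drop-∷-Empty e))
disjoint⇒∣p∪q∣≡∣p∣+∣q∣ (outside ∷ p) (inside  ∷ q) e =
  trans (cong suc (disjoint⇒∣p∪q∣≡∣p∣+∣q∣ p q (drop-∷-Empty e))) (sym (ℕ.+-suc _ _))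
disjoint⇒∣p∪q∣≡∣p∣+∣q∣ (inside  ∷ p) (inside  ∷ q) e = contradiction (zero , here) e

x∉p⇒∣p∪⁅x⁆∣≡1+∣p∣ : ∀ {x} {p : Subset n} → x ∉ p → ∣ p ∪ ⁅ x ⁆ ∣ ≡ suc ∣ p ∣
x∉p⇒∣p∪⁅x⁆∣≡1+∣p∣ {x = x} {p} x∉p = begin
  ∣ p ∪ ⁅ x ⁆ ∣      ≡⟨ disjoint⇒∣p∪q∣≡∣p∣+∣q∣ p ⁅ x ⁆ disj ⟩
  ∣ p ∣ + ∣ ⁅ x ⁆ ∣  ≡⟨ cong (∣ p ∣ +_) (∣⁅x⁆∣≡1 x) ⟩
  ∣ p ∣ + 1          ≡⟨ ℕ.+-comm ∣ p ∣ 1 ⟩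
  suc ∣ p ∣          ∎
  where
  open ≡-Reasoning
  disj : Empty (p ∩ ⁅ x ⁆)
  disj (y , y∈) with y∈p , y∈x ← x∈p∩q⁻ p ⁅ x ⁆ y∈ = x∉p (subst (_∈ p) (x∈⁅y⁆⇒x≡y x y∈x) y∈p)

subsetOfSize : ∀ {k} → k ≤ⁿ n → ∃ λ (p : Subset n) → ∣ p ∣ ≡ k
subsetOfSize {n} z≤n = ⊥ , ∣⊥∣≡0 n
subsetOfSize (s≤s k≤n) with p , ∣p∣≡k ← subsetOfSize k≤n = inside ∷ p , cong suc ∣p∣≡k

-- Images and preimages

∈-tabulate⁺ : ∀ {f : Fin n → Side} {v} → f v ≡ inside → v ∈ tabulate f
∈-tabulate⁺ {f = f} {v} fv = lookup⇒[]= v _ (trans (lookup∘tabulate f v) fv)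

∈-tabulate⁻ : ∀ {f : Fin n → Side} {v} → v ∈ tabulate f → f v ≡ inside
∈-tabulate⁻ {f = f} {v} v∈ = trans (sym (lookup∘tabulate f v)) ([]=⇒lookup v∈)

module _ (f : Fin m → Fin n) where

  preimage : Subset n → Subset m
  preimage q = tabulate (lookup q ∘ f)

  ∈-preimage⁺ : ∀ {q x} → f x ∈ q → x ∈ preimage q
  ∈-preimage⁺ = ∈-tabulate⁺ ∘ []=⇒lookup

  ∈-preimage⁻ : ∀ {q x} → x ∈ preimage q → f x ∈ q
  ∈-preimage⁻ = lookup⇒[]= _ _ ∘ ∈-tabulate⁻

  ∈-image⁺ : ∀ {p x} → x ∈ p → f x ∈ image f p
  ∈-image⁺ x∈p = ∈-tabulate⁺ (Equivalence.to T-≡ (fromWitness (_ , x∈p , refl)))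

  ∈-image⁻ : ∀ {p v} → v ∈ image f p → ∃ λ x → x ∈ p × f x ≡ v
  ∈-image⁻ {p} {v} v∈ =
    toWitness {a? = any? (λ x → (x ∈? p) ×-dec (f x ≟ᶠ v))} (Equivalence.from T-≡ (∈-tabulate⁻ v∈))

  -- The projection formula for `f`. It moves the question of how an embedded edge meets `A` back to
  -- the vertex set of the copied 3-graph.
  image-∩-preimage : ∀ p q → image f (p ∩ preimage q) ≡ image f p ∩ q
  image-∩-preimage p q = ⊆-antisym to from
    where
    to : image f (p ∩ preimage q) ⊆ image f p ∩ q
    to v∈ with x , x∈ , refl ← ∈-image⁻ v∈ with x∈p , x∈f⁻q ← x∈p∩q⁻ p _ x∈ =
      x∈p∩q⁺ (∈-image⁺ x∈p , ∈-preimage⁻ x∈f⁻q)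
    from : image f p ∩ q ⊆ image f (p ∩ preimage q)
    from v∈ with v∈f , v∈q ← x∈p∩q⁻ (image f p) q v∈ with x , x∈p , refl ← ∈-image⁻ v∈f =
      ∈-image⁺ (x∈p∩q⁺ (x∈p , ∈-preimage⁺ v∈q))

-- Together with `image-inside` this is the recursion on the first vertex that lets `∣image∣` go by
-- induction on the subset.
image-outside : (f : Fin (suc m) → Fin n) (p : Subset m) →
                image f (outside ∷ p) ≡ image (f ∘ suc) p
image-outside f p = ⊆-antisym to from
  where
  to : image f (outside ∷ p) ⊆ image (f ∘ suc) p
  to v∈ with ∈-image⁻ f v∈
  ... | suc x , there x∈p , refl = ∈-image⁺ (f ∘ suc) x∈p
  from : image (f ∘ suc) p ⊆ image f (outside ∷ p)
  from v∈ with x , x∈p , refl ← ∈-image⁻ (f ∘ suc) v∈ = ∈-image⁺ f (there x∈p)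

image-inside : (f : Fin (suc m) → Fin n) (p : Subset m) →
               image f (inside ∷ p) ≡ image (f ∘ suc) p ∪ ⁅ f zero ⁆
image-inside f p = ⊆-antisym to from
  where
  to : image f (inside ∷ p) ⊆ image (f ∘ suc) p ∪ ⁅ f zero ⁆
  to v∈ with ∈-image⁻ f v∈
  ... | zero  , here      , refl = x∈p∪q⁺ (inj₂ (x∈⁅x⁆ (f zero)))
  ... | suc x , there x∈p , refl = x∈p∪q⁺ (inj₁ (∈-image⁺ (f ∘ suc) x∈p))
  from : image (f ∘ suc) p ∪ ⁅ f zero ⁆ ⊆ image f (inside ∷ p)
  from v∈ with x∈p∪q⁻ (image (f ∘ suc) p) ⁅ f zero ⁆ v∈
  ... | inj₂ v∈0 rewrite x∈⁅y⁆⇒x≡y (f zero) v∈0 = ∈-image⁺ f here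
  ... | inj₁ v∈f with x , x∈p , refl ← ∈-image⁻ (f ∘ suc) v∈f = ∈-image⁺ f (there x∈p)

∣image∣ : (f : Fin m → Fin n) → Injective _≡_ _≡_ f → ∀ p → ∣ image f p ∣ ≡ ∣ p ∣
∣image∣ {n = n} f inj [] =
  trans (cong ∣_∣ (Empty-unique {p = image f []} λ (v , v∈) → no-preimage (∈-image⁻ f v∈))) (∣⊥∣≡0 n)
  where
  no-preimage : ∀ {v} → ¬ ∃ λ x → x ∈ [] × f x ≡ v
  no-preimage (() , _)
∣image∣ f inj (outside ∷ p) =
  trans (cong ∣_∣ (image-outside f p)) (∣image∣ (f ∘ suc) (suc-injective ∘ inj) p)
∣image∣ f inj (inside ∷ p) = begin
  ∣ image f (inside ∷ p) ∣              ≡⟨ cong ∣_∣ (image-inside f p) ⟩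
  ∣ image (f ∘ suc) p ∪ ⁅ f zero ⁆ ∣    ≡⟨ x∉p⇒∣p∪⁅x⁆∣≡1+∣p∣ f0∉ ⟩
  suc ∣ image (f ∘ suc) p ∣             ≡⟨ cong suc (∣image∣ (f ∘ suc) (suc-injective ∘ inj) p) ⟩
  suc ∣ p ∣                             ∎
  where
  open ≡-Reasoning
  f0∉ : f zero ∉ image (f ∘ suc) p
  -- Injectivity would give `suc x ≡ zero`, so `f zero` is a new element of the image.
  f0∉ f0∈ with x , _ , fx≡f0 ← ∈-image⁻ (f ∘ suc) f0∈ with () ← inj fx≡f0

∣image∩∣ : (f : Fin m → Fin n) → Injective _≡_ _≡_ f → ∀ p q →
           ∣ image f p ∩ q ∣ ≡ ∣ p ∩ preimage f q ∣
∣image∩∣ f inj p q =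
  trans (cong ∣_∣ (sym (image-∩-preimage f p q))) (∣image∣ f inj (p ∩ preimage f q))

-- Partitions into a finite family of parts

∑ : ∀ {c} → (Fin c → ℕ) → ℕ
∑ f = sum (List.tabulate f)

∑-cong : ∀ {c} {f g : Fin c → ℕ} → (∀ i → f i ≡ g i) → ∑ f ≡ ∑ g
∑-cong {zero}  f≗g = refl
∑-cong {suc c} f≗g = cong₂ _+_ (f≗g zero) (∑-cong (f≗g ∘ suc))

-- Used with `d = 3` to follow a size modulo 3, and with `d = 0` to evaluate a sum of equal terms
-- exactly.
∑-residue : ∀ b d {c} (f : Fin c → ℕ) → (∀ i → ∃ λ k → f i ≡ b + k * d) →
            ∃ λ k → ∑ f ≡ c * b + k * d
∑-residue b d {zero}  f h = 0 , refl
∑-residue b d {suc c} f h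
  with k , f0≡ ← h zero | l , ∑≡ ← ∑-residue b d (f ∘ suc) (h ∘ suc) =
  k + l , trans (cong₂ _+_ f0≡ ∑≡) (rearrange b k d (c * b) l)
  where
  rearrange : ∀ b k d e l → b + k * d + (e + l * d) ≡ b + e + (k + l) * d
  rearrange = solve-∀

-- Induction on the number of parts: splitting off `V zero` leaves the remaining parts as a
-- partition of `q ∩ ∁ (V zero)`.
∣partition∣ : ∀ {c} (V : Fin c → Subset n) (q : Subset n) →
              (∀ i j x → x ∈ V i → x ∈ V j → i ≡ j) →
              (∀ i → V i ⊆ q) →
              (∀ {x} → x ∈ q → ∃ λ i → x ∈ V i) →
              ∣ q ∣ ≡ ∑ (λ i → ∣ V i ∣)
∣partition∣ {n} {zero} V q _ _ cover =
  trans (cong ∣_∣ (Empty-unique {p = q} λ (x , x∈q) → no-part (cover x∈q))) (∣⊥∣≡0 n)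
  where
  no-part : ∀ {x} → ¬ ∃ λ i → x ∈ V i
  no-part (() , _)
∣partition∣ {n} {suc c} V q disj V⊆q cover = begin
  ∣ q ∣                          ≡⟨ ∣p∣≡∣p∩q∣+∣p∩∁q∣ q (V zero) ⟩
  ∣ q ∩ V zero ∣ + ∣ q ∩ ∁ (V zero) ∣
    ≡⟨ cong₂ _+_ (cong ∣_∣ q∩V₀≡V₀) (∣partition∣ (V ∘ suc) (q ∩ ∁ (V zero)) disj′ sub′ cover′) ⟩
  ∣ V zero ∣ + ∑ (λ i → ∣ V (suc i) ∣)  ∎
  where
  open ≡-Reasoning
  q∩V₀≡V₀ : q ∩ V zero ≡ V zero
  q∩V₀≡V₀ = ⊆-antisym (p∩q⊆q q (V zero)) λ x∈ → x∈p∩q⁺ (V⊆q zero x∈ , x∈)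
  disj′ : ∀ i j x → x ∈ V (suc i) → x ∈ V (suc j) → i ≡ j
  disj′ i j x x∈i x∈j = suc-injective (disj (suc i) (suc j) x x∈i x∈j)
  sub′ : ∀ i → V (suc i) ⊆ q ∩ ∁ (V zero)
  sub′ i {x} x∈ = x∈p∩q⁺ (V⊆q (suc i) x∈ , x∉p⇒x∈∁p x∉V₀)
    where
    x∉V₀ : x ∉ V zero
    x∉V₀ x∈V₀ with () ← disj zero (suc i) x x∈V₀ x∈
  cover′ : ∀ {x} → x ∈ q ∩ ∁ (V zero) → ∃ λ i → x ∈ V (suc i)
  cover′ x∈ with x∈q , x∈∁ ← x∈p∩q⁻ q _ x∈ with cover x∈q
  ... | zero  , x∈V₀ = contradiction x∈V₀ (x∈∁p⇒x∉p x∈∁)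
  ... | suc i , x∈V  = i , x∈V

-- The copies of a factor cut `p` into the parts `V i`: disjointness separates the parts and
-- spanning makes them cover `p`. Each embedding is injective, so a part is as large as its
-- preimage.
∣p∣≡∑∣preimage∣ : {F : 3Graph m} {H : 3Graph n} (φ : Factor F H) (p : Subset n) →
                  ∣ p ∣ ≡ ∑ (λ i → ∣ preimage (embed (Factor.copy φ i)) p ∣)
∣p∣≡∑∣preimage∣ φ p =
  trans (∣partition∣ V p disj sub cover)
        (∑-cong λ i → ∣image∣ (e i) (injective (copy i)) (preimage (e i) p))
  where
  open Factor φ
  e = λ i → embed (copy i)
  V = λ i → image (e i) (preimage (e i) p)
  disj : ∀ i j x → x ∈ V i → x ∈ V j → i ≡ j
  disj i j v v∈i v∈j with x , _ , refl ← ∈-image⁻ (e i) v∈i with y , _ , eq ← ∈-image⁻ (e j) v∈j =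
    disjoint i j x y (sym eq)
  sub : ∀ i → V i ⊆ p
  sub i v∈ with x , x∈ , refl ← ∈-image⁻ (e i) v∈ = ∈-preimage⁻ (e i) x∈
  cover : ∀ {v} → v ∈ p → ∃ λ i → v ∈ V i
  cover {v} v∈p with i , x , refl ← spanning v = i , ∈-image⁺ (e i) (∈-preimage⁺ (e i) v∈p)

-- The extremal 3-graph

oddEdge? : (A e : Subset n) → Dec (∣ e ∣ ≡ 3 × ∣ e ∩ A ∣ % 2 ≡ 1)
oddEdge? A e = (∣ e ∣ ℕ.≟ 3) ×-dec (∣ e ∩ A ∣ % 2 ℕ.≟ 1)

oddGraph : Subset n → 3Graph n
oddGraph A = record
  { edge    = λ e → ⌊ oddEdge? A e ⌋
  ; uniform = λ e h → proj₁ (toWitness {a? = oddEdge? A e} h)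
  }

-- How copies and factors meet `A`

∣copy∩A∣ : (A : Subset n) (κ : Copy K₄³-e (oddGraph A)) →
           ∃ λ k → ∣ preimage (embed κ) A ∣ ≡ 1 + k * 3
∣copy∩A∣ A κ = sizes (preimage (embed κ) A)
  -- The three edges of `K₄³-e` all contain vertex 0. The `_` stands for the proof of being an edge,
  -- which is found by computation.
  (odd (inside ∷ inside  ∷ inside  ∷ outside ∷ []) _)
  (odd (inside ∷ inside  ∷ outside ∷ inside  ∷ []) _)
  (odd (inside ∷ outside ∷ inside  ∷ inside  ∷ []) _)
  where
  odd : ∀ e → Edge K₄³-e e → ∣ e ∩ preimage (embed κ) A ∣ % 2 ≡ 1
  odd e h = trans (cong (_% 2) (sym (∣image∩∣ (embed κ) (injective κ) e A)))
                  (proj₂ (toWitness {a? = oddEdge? A (image (embed κ) e)} (preserves κ e h)))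
  -- If 0 lies in `P`, every pair from {1,2,3} meets `P` in an even number, so `P` contains all or
  -- none of 1, 2, 3. If 0 is not in `P`, every such pair would have exactly one vertex in `P`,
  -- which is impossible for three vertices.
  sizes : (P : Subset 4) →
          ∣ (inside ∷ inside  ∷ inside  ∷ outside ∷ []) ∩ P ∣ % 2 ≡ 1 →
          ∣ (inside ∷ inside  ∷ outside ∷ inside  ∷ []) ∩ P ∣ % 2 ≡ 1 →
          ∣ (inside ∷ outside ∷ inside  ∷ inside  ∷ []) ∩ P ∣ % 2 ≡ 1 →
          ∃ λ k → ∣ P ∣ ≡ 1 + k * 3
  sizes (inside  ∷ inside  ∷ inside  ∷ inside  ∷ []) _ _ _ = 1 , refl
  sizes (inside  ∷ outside ∷ outside ∷ outside ∷ []) _ _ _ = 0 , refl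
  -- These three singletons each miss an edge, so the cases are vacuous; their size 1 has the
  -- required form anyway.
  sizes (outside ∷ inside  ∷ outside ∷ outside ∷ []) _ _ _ = 0 , refl
  sizes (outside ∷ outside ∷ inside  ∷ outside ∷ []) _ _ _ = 0 , refl
  sizes (outside ∷ outside ∷ outside ∷ inside  ∷ []) _ _ _ = 0 , refl
  sizes (inside  ∷ inside  ∷ inside  ∷ outside ∷ []) _ () _
  sizes (inside  ∷ inside  ∷ outside ∷ _       ∷ []) () _ _
  sizes (inside  ∷ outside ∷ inside  ∷ _       ∷ []) () _ _
  sizes (inside  ∷ outside ∷ outside ∷ inside  ∷ []) _ () _
  sizes (outside ∷ inside  ∷ inside  ∷ _       ∷ []) () _ _
  sizes (outside ∷ inside  ∷ outside ∷ inside  ∷ []) _ () _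
  sizes (outside ∷ outside ∷ inside  ∷ inside  ∷ []) _ _ ()
  sizes (outside ∷ outside ∷ outside ∷ outside ∷ []) () _ _

-- Each copy contributes 1 modulo 3 to `∣ A ∣`, and a factor in order `k * 4` has exactly `k`
-- copies.
factor⇒∣A∣-residue : ∀ k (A : Subset (k * 4)) → Factor K₄³-e (oddGraph A) →
                     ∃ λ l → ∣ A ∣ ≡ k + l * 3
factor⇒∣A∣-residue k A φ with ∑-residue 1 3 _ (λ i → ∣copy∩A∣ A (Factor.copy φ i))
... | l , ∑≡ = l , (begin
  ∣ A ∣                                                  ≡⟨ ∣p∣≡∑∣preimage∣ φ A ⟩
  ∑ (λ i → ∣ preimage (embed (Factor.copy φ i)) A ∣)     ≡⟨ ∑≡ ⟩
  Factor.count φ * 1 + l * 3                             ≡⟨ cong (_+ l * 3) (ℕ.*-identityʳ _) ⟩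
  Factor.count φ + l * 3                                 ≡⟨ cong (_+ l * 3) count≡k ⟩
  k + l * 3                                              ∎)
  where
  open ≡-Reasoning
  -- Counting the full vertex set by the same partition gives the number of copies. The summand
  -- `0 * 0` matches the form of `∑-residue` with step 0.
  preimage-⊤ : ∀ i → ∣ preimage (embed (Factor.copy φ i)) ⊤ ∣ ≡ 4 + 0 * 0
  preimage-⊤ i = trans (cong ∣_∣ (⊆-antisym (λ _ → ∈⊤) λ _ → ∈-preimage⁺ (embed (Factor.copy φ i)) ∈⊤))
                       (∣⊤∣≡n 4)
  count≡k : Factor.count φ ≡ k
  count≡k with j , ∑⊤≡ ← ∑-residue 4 0 _ (λ i → 0 , preimage-⊤ i) = sym (ℕ.*-cancelʳ-≡ k _ 4 (begin
    k * 4                     ≡⟨ ∣⊤∣≡n (k * 4) ⟨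
    ∣ ⊤ {k * 4} ∣             ≡⟨ ∣p∣≡∑∣preimage∣ φ ⊤ ⟩
    _                         ≡⟨ ∑⊤≡ ⟩
    Factor.count φ * 4 + j * 0  ≡⟨ cong (Factor.count φ * 4 +_) (ℕ.*-zeroʳ j) ⟩
    Factor.count φ * 4 + 0    ≡⟨ ℕ.+-identityʳ _ ⟩
    Factor.count φ * 4        ∎))

-- Minimum codegree of the odd graph

∣S∣≤deg : (H : 3Graph n) (p S : Subset n) →
          (∀ {v} → v ∈ S → Edge H (p ∪ ⁅ v ⁆)) → ∣ S ∣ ≤ⁿ deg H p
∣S∣≤deg H p S h = p⊆q⇒∣p∣≤∣q∣ {p = S} (λ v∈ → ∈-tabulate⁺ (Equivalence.to T-≡ (h v∈)))

module _ (A : Subset n) where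

  ∣[p∪⁅v⁆]∩A∣-in : ∀ {p v} → v ∈ A → v ∉ p → ∣ (p ∪ ⁅ v ⁆) ∩ A ∣ ≡ suc ∣ p ∩ A ∣
  ∣[p∪⁅v⁆]∩A∣-in {p} {v} v∈A v∉p = begin
    ∣ (p ∪ ⁅ v ⁆) ∩ A ∣          ≡⟨ cong ∣_∣ (∩-distribʳ-∪ A p ⁅ v ⁆) ⟩
    ∣ (p ∩ A) ∪ (⁅ v ⁆ ∩ A) ∣    ≡⟨ cong (λ q → ∣ (p ∩ A) ∪ q ∣) ⁅v⁆∩A≡⁅v⁆ ⟩
    ∣ (p ∩ A) ∪ ⁅ v ⁆ ∣          ≡⟨ x∉p⇒∣p∪⁅x⁆∣≡1+∣p∣ (v∉p ∘ p∩q⊆p p A) ⟩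
    suc ∣ p ∩ A ∣                ∎
    where
    open ≡-Reasoning
    ⁅v⁆∩A≡⁅v⁆ : ⁅ v ⁆ ∩ A ≡ ⁅ v ⁆
    ⁅v⁆∩A≡⁅v⁆ = ⊆-antisym (p∩q⊆p ⁅ v ⁆ A)
      λ x∈ → x∈p∩q⁺ (x∈ , subst (_∈ A) (sym (x∈⁅y⁆⇒x≡y v x∈)) v∈A)

  ∣[p∪⁅v⁆]∩A∣-out : ∀ {p v} → v ∉ A → ∣ (p ∪ ⁅ v ⁆) ∩ A ∣ ≡ ∣ p ∩ A ∣
  ∣[p∪⁅v⁆]∩A∣-out {p} {v} v∉A = cong ∣_∣ (begin
    (p ∪ ⁅ v ⁆) ∩ A          ≡⟨ ∩-distribʳ-∪ A p ⁅ v ⁆ ⟩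
    (p ∩ A) ∪ (⁅ v ⁆ ∩ A)    ≡⟨ cong ((p ∩ A) ∪_) (Empty-unique ⁅v⁆∩A-empty) ⟩
    (p ∩ A) ∪ ⊥              ≡⟨ ∪-identityʳ (p ∩ A) ⟩
    p ∩ A                    ∎)
    where
    open ≡-Reasoning
    ⁅v⁆∩A-empty : Empty (⁅ v ⁆ ∩ A)
    ⁅v⁆∩A-empty (x , x∈) with x∈v , x∈A ← x∈p∩q⁻ ⁅ v ⁆ A x∈ =
      v∉A (subst (_∈ A) (x∈⁅y⁆⇒x≡y v x∈v) x∈A)

  module _ (p : Subset n) (∣p∣≡2 : ∣ p ∣ ≡ 2) where

    private
      toEdge : ∀ {v} → v ∉ p → ∣ (p ∪ ⁅ v ⁆) ∩ A ∣ % 2 ≡ 1 → Edge (oddGraph A) (p ∪ ⁅ v ⁆)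
      toEdge v∉p odd = fromWitness (trans (x∉p⇒∣p∪⁅x⁆∣≡1+∣p∣ v∉p) (cong suc ∣p∣≡2) , odd)

    -- Evenness of `∣ p ∩ A ∣` is expressed as oddness of its successor, the number of vertices in
    -- `A` once `v` is added.
    even⇒edge : suc ∣ p ∩ A ∣ % 2 ≡ 1 → ∀ {v} → v ∈ A ∩ ∁ p → Edge (oddGraph A) (p ∪ ⁅ v ⁆)
    even⇒edge even v∈ with v∈A , v∈∁p ← x∈p∩q⁻ A (∁ p) v∈ =
      toEdge v∉p (trans (cong (_% 2) (∣[p∪⁅v⁆]∩A∣-in {p} v∈A v∉p)) even)
      where v∉p = x∈∁p⇒x∉p v∈∁p

    odd⇒edge : ∣ p ∩ A ∣ % 2 ≡ 1 → ∀ {v} → v ∈ ∁ A ∩ ∁ p → Edge (oddGraph A) (p ∪ ⁅ v ⁆)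
    odd⇒edge odd v∈ with v∈∁A , v∈∁p ← x∈p∩q⁻ (∁ A) (∁ p) v∈ =
      toEdge (x∈∁p⇒x∉p v∈∁p) (trans (cong (_% 2) (∣[p∪⁅v⁆]∩A∣-out {p} (x∈∁p⇒x∉p v∈∁A))) odd)

    -- Every vertex of `A` outside `p` completes an edge, and `p` takes at most its own two vertices
    -- away from `A`.
    even⇒∣A∣≤2+deg : suc ∣ p ∩ A ∣ % 2 ≡ 1 → ∣ A ∣ ≤ⁿ 2 + deg (oddGraph A) p
    even⇒∣A∣≤2+deg even = begin
      ∣ A ∣                      ≡⟨ ∣p∣≡∣p∩q∣+∣p∩∁q∣ A p ⟩
      ∣ A ∩ p ∣ + ∣ A ∩ ∁ p ∣
        ≤⟨ ℕ.+-mono-≤ (∣p∩q∣≤∣q∣ A p) (∣S∣≤deg (oddGraph A) p _ (even⇒edge even)) ⟩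
      ∣ p ∣ + deg (oddGraph A) p ≡⟨ cong (_+ deg (oddGraph A) p) ∣p∣≡2 ⟩
      2 + deg (oddGraph A) p     ∎
      where open ℕ.≤-Reasoning

    -- Every vertex of `∁ A` outside `p` completes an edge, and just one vertex of `p` lies in
    -- `∁ A`.
    ∣p∩A∣≡1⇒∣∁A∣≤1+deg : ∣ p ∩ A ∣ ≡ 1 → ∣ ∁ A ∣ ≤ⁿ 1 + deg (oddGraph A) p
    ∣p∩A∣≡1⇒∣∁A∣≤1+deg ∣p∩A∣≡1 = begin
      ∣ ∁ A ∣                        ≡⟨ ∣p∣≡∣p∩q∣+∣p∩∁q∣ (∁ A) p ⟩
      ∣ ∁ A ∩ p ∣ + ∣ ∁ A ∩ ∁ p ∣
        ≤⟨ ℕ.+-mono-≤ (ℕ.≤-reflexive ∣∁A∩p∣≡1)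
                      (∣S∣≤deg (oddGraph A) p _ (odd⇒edge (cong (_% 2) ∣p∩A∣≡1))) ⟩
      1 + deg (oddGraph A) p         ∎
      where
      open ℕ.≤-Reasoning
      ∣∁A∩p∣≡1 : ∣ ∁ A ∩ p ∣ ≡ 1
      ∣∁A∩p∣≡1 = trans (cong ∣_∣ (∩-comm (∁ A) p)) (ℕ.suc-injective
        (trans (cong (_+ ∣ p ∩ ∁ A ∣) (sym ∣p∩A∣≡1)) (trans (sym (∣p∣≡∣p∩q∣+∣p∩∁q∣ p A)) ∣p∣≡2)))

    -- Pairs with 0 or 2 vertices in `A` are completed from `A`, those with 1 from `∁ A`; hence the
    -- different losses 2 and 1.
    d≤deg : ∀ {d} → 2 + d ≤ⁿ ∣ A ∣ → 1 + d ≤ⁿ ∣ ∁ A ∣ → d ≤ⁿ deg (oddGraph A) p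
    d≤deg 2+d≤ 1+d≤ with ∣ p ∩ A ∣ in eq | subst (∣ p ∩ A ∣ ≤ⁿ_) ∣p∣≡2 (∣p∩q∣≤∣p∣ p A)
    ... | 0 | _ = ℕ.+-cancelˡ-≤ 2 _ _ (ℕ.≤-trans 2+d≤ (even⇒∣A∣≤2+deg (cong (λ j → suc j % 2) eq)))
    ... | 1 | _ = ℕ.+-cancelˡ-≤ 1 _ _ (ℕ.≤-trans 1+d≤ (∣p∩A∣≡1⇒∣∁A∣≤1+deg eq))
    ... | 2 | _ = ℕ.+-cancelˡ-≤ 2 _ _ (ℕ.≤-trans 2+d≤ (even⇒∣A∣≤2+deg (cong (λ j → suc j % 2) eq)))
    ... | suc (suc (suc _)) | s≤s (s≤s ())

  d≤δ₂ : ∀ {d} → 2 + d ≤ⁿ ∣ A ∣ → 1 + d ≤ⁿ ∣ ∁ A ∣ → d ≤ⁿ δ₂ (oddGraph A)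
  -- The first argument of `v≤min⁺` compares `d` with `n`, the default value of the minimum in `δ₂`.
  d≤δ₂ {d} 2+d≤ 1+d≤ = v≤min⁺ (ℕ.≤-trans (ℕ.m≤n+m d 2) (ℕ.≤-trans 2+d≤ (∣p∣≤n A)))
    (All.map⁺ (All.tabulate λ {p} p∈ →
      d≤deg p (proj₂ (∈-filter⁻ (λ q → ∣ q ∣ ℕ.≟ 2) {xs = allSubsets n} p∈)) 2+d≤ 1+d≤))

-- Opened only here: +_ and _∣_ make sections of _+_ and the sizes ∣_∣ ambiguous.
open import Data.Integer.Base using (ℤ; +_; _-_; _≤_; 1ℤ; +≤+)
open import Data.Nat.Divisibility using (_∣_; divides; _∣?_; ∣m+n∣m⇒∣n; ∣1⇒≡1)

-- Choice of the size of `A` and conclusion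

nonresidueSize : ∀ k → ∃ λ a → k * 2 ≤ⁿ a × a ≤ⁿ 1 + k * 2 × ¬ ∃ λ l → a ≡ k + l * 3
nonresidueSize k with 3 ∣? k
-- An equation `k * 2 ≡ k + l * 3` would give `k ≡ l * 3`.
... | no 3∤k = k * 2 , ℕ.≤-refl , ℕ.n≤1+n _ , λ (l , eq) →
  3∤k (divides l (ℕ.+-cancelˡ-≡ k _ _ (trans (double k) eq)))
  where
  double : ∀ k → k + k ≡ k * 2
  double = solve-∀
-- Here the equation would make 3 divide `k + 1` as well as `k`, hence 1.
... | yes 3∣k = 1 + k * 2 , ℕ.n≤1+n _ , ℕ.≤-refl , λ (l , eq) →
  contradiction (∣1⇒≡1 (∣m+n∣m⇒∣n (divides l (ℕ.+-cancelˡ-≡ k _ _ (trans (double k) eq))) 3∣k)) λ ()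
  where
  double : ∀ k → k + (k + 1) ≡ 1 + k * 2
  double = solve-∀

-- With order n = 4(k + 1), the bound n/2 - 2 is `k * 2`, free of subtraction. The size `a` is 2k +
-- 2 or 2k + 3, and both leave at least 2k + 1 vertices in the complement, as `d≤δ₂` requires.
oddGraph-without-factor : ∀ k → ∃ λ (A : Subset (suc k * 4)) →
  k * 2 ≤ⁿ δ₂ (oddGraph A) × ¬ Factor K₄³-e (oddGraph A)
oddGraph-without-factor k with a , 2k+2≤a , a≤2k+3 , ¬residue ← nonresidueSize (suc k) =
  A
  , d≤δ₂ A (subst (2 + k * 2 ≤ⁿ_) (sym ∣A∣≡a) 2k+2≤a)
           (subst (1 + k * 2 ≤ⁿ_) (sym ∣∁A∣≡) (ℕ.m+n≤o⇒m≤o∸n _ room))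
  , λ φ → ¬residue
      (subst (λ b → ∃ λ l → b ≡ suc k + l * 3) ∣A∣≡a (factor⇒∣A∣-residue (suc k) A φ))
  where
  total : ∀ k → 1 + k * 2 + (3 + k * 2) ≡ 4 + k * 4
  total = solve-∀
  -- The extreme case is tight: 2k + 1 and 2k + 3 add up to the order. The same inequality shows
  -- that a subset of size `a` exists.
  room : 1 + k * 2 + a ≤ⁿ suc k * 4
  room = ℕ.≤-trans (ℕ.+-monoʳ-≤ (1 + k * 2) a≤2k+3) (ℕ.≤-reflexive (total k))
  sized : ∃ λ (A : Subset (suc k * 4)) → ∣ A ∣ ≡ a
  sized = subsetOfSize (ℕ.m+n≤o⇒n≤o (1 + k * 2) room)
  A = proj₁ sized
  ∣A∣≡a = proj₂ sized
  ∣∁A∣≡ : ∣ ∁ A ∣ ≡ suc k * 4 ∸ a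
  ∣∁A∣≡ = trans (∣∁p∣≡n∸∣p∣ A) (cong (suc k * 4 ∸_) ∣A∣≡a)

proposition1p1 : (n : ℕ) → 0 < n → 4 ∣ n →
    (t : ℤ) → IsThreshold n K₄³-e t → + (n / 2) - 1ℤ ≤ t
proposition1p1 .(suc k * 4) _ (divides (suc k) refl) t (forces , _) = ℤ.≮⇒≥ λ t< →
  let A , k*2≤δ₂ , ¬factor = oddGraph-without-factor k
      -- Over the integers, t < n/2 - 1 means t ≤ n/2 - 2, and the predecessor computes to
      -- `+ (k * 2)`. So the odd graph meets the codegree condition for `t`.
      t≤k*2 = ℤ.i<j⇒i≤pred[j] (subst (λ h → t ℤ.< + h - 1ℤ) half t<)
  in ¬factor (forces (oddGraph A) (ℤ.≤-trans t≤k*2 (+≤+ k*2≤δ₂)))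
  where
  half : suc k * 4 / 2 ≡ suc k * 2
  half = trans (cong (_/ 2) (sym (ℕ.*-assoc (suc k) 2 2))) (m*n/n≡m (suc k * 2) 2)
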